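{- Let $k$ be a positive integer. Let $G=(V,E,\partial)$ be a finite undirected graph with $V$ the disjoint union of $\{v_1,v_2,v_3,v_4\}$ (four distinct vertices) and a (possibly empty) set $Y$, such that every vertex $y\in Y$ has even degree in $G$. Suppose that after the deletion of any $k-1$ or fewer edges from $G$, the four vertices $v_1,v_2,v_3,v_4$ can be split into two disjoint pairs $\{v_a,v_b\}$ and $\{v_c,v_d\}$ such that there exist two paths $P_1$ between $v_a$ and $v_b$ and $P_2$ between $v_c$ and $v_d$ having no common edges. Then the four vertices can be split $k$ times into two disjoint pairs $\{v_{a(j)},v_{b(j)}\}$ and $\{v_{c(j)},v_{d(j)}\}$, $j=1,\ldots,k$, such that the two vertices in each of these $2k$ pairs can be connected by a path in $G$ and no two of these $2k$ paths have a common edge.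
   Context: A graph $G=(V,E,\partial)$ consists of a finite nonempty vertex set $V$, a finite edge set $E$, and a map $\partial$ assigning to each edge a set of exactly two distinct vertices (parallel edges allowed, no loops). The degree of a vertex $v$ is the number of edges $e$ with $v\in\partial(e)$. A path between vertices $u$ and $v$ is an alternating sequence $(w_0,e_1,w_1,\ldots,e_t,w_t)$ of vertices and edges with $\{w_0,w_t\}=\{u,v\}$ as endpoints, $\partial(e_i)=\{w_{i-1},w_i\}$ for all $i$, and $e_i\ne e_j$ for $i\ne j$ (vertices may repeat). Deleting edges means removing them from $E$ (the vertex set is unchanged). -}

module Defs where

open import Data.Nat using (ℕ; _<_)
open import Data.Nat.Divisibility using (_∣_)
open import Data.Fin using (Fin; zero; suc)
open import Data.Fin.Subset using (Subset; _∉_; ∣_∣)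
open import Data.Product using (Σ; _×_; _,_; proj₁; proj₂; ∃; ∃-syntax)
open import Data.Sum using (_⊎_)
open import Data.List using (List; []; _∷_; length; filter)
open import Data.List.Membership.Propositional using (_∈_)
open import Data.List.Relation.Unary.All using (All)
open import Data.List.Relation.Unary.Unique.Propositional using (Unique)
open import Data.List.Base using (allFin)
open import Relation.Binary.PropositionalEquality using (_≡_; _≢_)
open import Relation.Nullary using (¬_)
open import Data.Fin using (_≟_)
open import Data.Sum.Relation.Unary.All using () 
open import Relation.Nullary.Decidable using (_⊎-dec_)
open import Function using (Injective)

-- A finite multigraph without loops: vertices Fin n, edges Fin m,
-- ∂ e = (x , y) lists the two (distinct) endpoints of e.
record Graph : Set where
  field
    n     : ℕ
    m     : ℕ
    ∂     : Fin m → Fin n × Fin n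
    loopless : ∀ e → proj₁ (∂ e) ≢ proj₂ (∂ e)

open Graph public

degree : (G : Graph) → Fin (n G) → ℕ
degree G v = length (filter (λ e → (proj₁ (∂ G e) ≟ v) ⊎-dec (proj₂ (∂ G e) ≟ v)) (allFin (m G)))

Joins : (G : Graph) → Fin (m G) → Fin (n G) → Fin (n G) → Set
Joins G e u w = (∂ G e ≡ (u , w)) ⊎ (∂ G e ≡ (w , u))

data Walk (G : Graph) : Fin (n G) → Fin (n G) → List (Fin (m G)) → Set where
  nil  : ∀ {u} → Walk G u u []
  cons : ∀ {u w v es} (e : Fin (m G)) → Joins G e u w → Walk G w v es → Walk G u v (e ∷ es)

-- A path between u and v: a walk with pairwise distinct edges (vertices may repeat)
record Path (G : Graph) (u v : Fin (n G)) : Set where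
  constructor mkPath
  field
    edges    : List (Fin (m G))
    walk     : Walk G u v edges
    distinct : Unique edges

open Path public

EdgeDisjoint : {G : Graph} {u v u' v' : Fin (n G)} → Path G u v → Path G u' v' → Set
EdgeDisjoint P Q = ∀ e → e ∈ edges P → e ∉ₗ edges Q
  where
  _∉ₗ_ : _ → List _ → Set
  x ∉ₗ xs = ¬ (x ∈ xs)

-- a path avoids a set D of (deleted) edges, i.e. it is a path of G - D
Avoids : {G : Graph} {u v : Fin (n G)} → Path G u v → Subset (m G) → Set
Avoids P D = All (λ e → e ∉ D) (edges P)

data Pairing : Set where
  12∣34 13∣24 14∣23 : Pairing

pair : Pairing → Fin 2 → Fin 4 × Fin 4
pair 12∣34 zero = (zero , suc zero)
pair 12∣34 (suc zero) = (suc (suc zero) , suc (suc (suc zero)))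
pair 13∣24 zero = (zero , suc (suc zero))
pair 13∣24 (suc zero) = (suc zero , suc (suc (suc zero)))
pair 14∣23 zero = (zero , suc (suc (suc zero)))
pair 14∣23 (suc zero) = (suc zero , suc (suc zero))

{-# OPTIONS --safe #-}
module Submission where

open import Defs
open import Data.Bool as Bool using (Bool; true; false; _∧_; _∨_; not; _xor_)
open import Data.Bool.Properties using (∧-idem; ∨-idem; xor-identityʳ)
open import Data.Fin using (Fin; zero; suc; _≟_)
open import Data.Fin.Patterns using (0F; 1F; 2F; 3F)
open import Data.Fin.Properties using (any?; all?)
open import Data.Fin.Subset using (Subset; ∣_∣; _∉_)
open import Data.Fin.Subset.Properties using (anySubset?)
open import Data.List using (List; []; _∷_; _++_; map; length; filter; concatMap; tabulate; allFin)
open import Data.List.Membership.Propositional using (_∈_)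
open import Data.List.Membership.Propositional.Properties using (∈-allFin; ∈-++⁺ˡ; ∈-++⁺ʳ)
open import Data.List.Properties using (map-tabulate; map-∘; ++-assoc)
open import Data.List.Relation.Binary.Permutation.Propositional as ↭
  using (_↭_; ↭-refl; ↭-sym; ↭-trans; ↭-reflexive; ↭⇒↭ₛ; module PermutationReasoning)
open import Data.List.Relation.Binary.Permutation.Propositional.Properties
  using (++⁺; ++⁺ˡ; ++⁺ʳ; map⁺; shifts; ∷↭∷ʳ; All-resp-↭; ∈-resp-↭; ↭-length)
import Data.List.Relation.Binary.Permutation.Setoid.Properties as ↭ₛ
open import Data.List.Relation.Unary.All as All using (All; []; _∷_)
import Data.List.Relation.Unary.All.Properties as All
open import Data.List.Relation.Unary.AllPairs using ([]; _∷_)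
open import Data.List.Relation.Unary.Any as Any using (Any; here; there)
open import Data.List.Relation.Unary.Unique.Propositional using (Unique)
open import Data.List.Relation.Unary.Unique.Propositional.Properties using (allFin⁺)
open import Data.Nat using (ℕ; zero; suc; _+_; _*_; _<_; _≤_; z≤n; s≤s; s≤s⁻¹; _%_; _/_)
open import Data.Nat.Divisibility using (_∣_; divides; ∣m∣n⇒∣m+n; ∣m+n∣m⇒∣n; ∣n⇒∣m*n; _∣0)
open import Data.Nat.DivMod using (m≡m%n+[m/n]*n; %-remove-+ˡ; [m+kn]%n≡m%n)
open import Data.Nat.Induction using (<-wellFounded)
open import Data.Nat.ListAction using (sum)
open import Data.Nat.ListAction.Properties using (sum-↭)
open import Data.Nat.Properties hiding (_≟_)
import Data.Nat.Properties as ℕ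
open import Data.Nat.Solver using (module +-*-Solver)
open import Data.Product using (Σ; _×_; _,_; proj₁; proj₂; ∃; ∃-syntax)
open import Data.Product.Properties using (≡-dec)
open import Data.Sum using (_⊎_; inj₁; inj₂; swap)
import Data.Vec as Vec
open import Data.Vec.Properties using (lookup∘tabulate; lookup⇒[]=)
open import Function using (Injective; _∘_)
open import Induction.WellFounded using (Acc; acc)
open import Relation.Binary.PropositionalEquality
open import Relation.Nullary using (¬_; Dec; yes; no; does; contradiction)
open import Relation.Nullary.Decidable
  using (True; toWitness; from-yes; dec-true; dec-false; _×-dec_; _⊎-dec_; ¬?)
open import Relation.Unary using (Decidable)

-- Only cuts Z containing exactly one terminal v i matter: deleting such a cut isolates v i from
-- the other terminals, so it has at least k edges, and by the handshake lemma the parity of its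
-- size depends on i alone.  Both facts say that the size is κ i plus an even number, for a fixed
-- κ i ≥ k.  As in the Lovász–Cherkassky theorem, as long as some edge joins a terminal s to a
-- non-terminal y, there is a second edge y–t such that replacing s–y and y–t by a single edge s–t
-- preserves this: an obstruction is a cut of size exactly κ i separating y from s and t, and such
-- cuts uncross.  When no such edge is left, the terminals span a multigraph on four vertices with
-- minimum degree at least k.  Remove perfect matchings while there are any; with none left, the
-- remaining edges form a star or a triangle, and minimum degree leaves only the star, whose edges
-- group into triples, each giving one concatenated path through the centre and one direct path.

-- Sums over lists.

Σₗ : {A : Set} → (A → ℕ) → List A → ℕ
Σₗ f xs = sum (map f xs)

Σₗ-mono : {A : Set} {f g : A → ℕ} {xs : List A} →
          All (λ x → f x ≤ g x) xs → Σₗ f xs ≤ Σₗ g xs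
Σₗ-mono []       = z≤n
Σₗ-mono (p ∷ ps) = +-mono-≤ p (Σₗ-mono ps)

Σₗ-mono-< : {A : Set} {f g : A → ℕ} {xs : List A} →
            (∀ x → f x ≤ g x) → Any (λ x → f x < g x) xs → Σₗ f xs < Σₗ g xs
Σₗ-mono-< {f = f} {g} {x ∷ xs} le (here p)  = +-mono-<-≤ p (Σₗ-mono {f = f} {g} (All.universal le xs))
Σₗ-mono-< {f = f} {g} {x ∷ xs} le (there p) = +-mono-≤-< (le x) (Σₗ-mono-< {f = f} {g} le p)

Σₗ-cong : {A : Set} {f g : A → ℕ} {xs : List A} →
          All (λ x → f x ≡ g x) xs → Σₗ f xs ≡ Σₗ g xs
Σₗ-cong []       = refl
Σₗ-cong (p ∷ ps) = cong₂ _+_ p (Σₗ-cong ps)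

Σₗ-∣ : {A : Set} {d : ℕ} {f : A → ℕ} → (∀ x → d ∣ f x) → ∀ xs → d ∣ Σₗ f xs
Σₗ-∣ p []       = _ ∣0
Σₗ-∣ p (x ∷ xs) = ∣m∣n⇒∣m+n (p x) (Σₗ-∣ p xs)

+-interchange : ∀ a b c d → (a + b) + (c + d) ≡ (a + c) + (b + d)
+-interchange = solve 4 (λ a b c d → (a :+ b) :+ (c :+ d) := (a :+ c) :+ (b :+ d)) refl
  where open +-*-Solver

Σₗ-+ : {A : Set} (f g : A → ℕ) (xs : List A) →
       Σₗ (λ x → f x + g x) xs ≡ Σₗ f xs + Σₗ g xs
Σₗ-+ f g []       = refl
Σₗ-+ f g (x ∷ xs) = trans (cong (f x + g x +_) (Σₗ-+ f g xs))
                          (+-interchange (f x) (g x) (Σₗ f xs) (Σₗ g xs))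

Σₗ-*ˡ : {A : Set} (c : ℕ) (f : A → ℕ) (xs : List A) →
        Σₗ (λ x → c * f x) xs ≡ c * Σₗ f xs
Σₗ-*ˡ c f []       = sym (*-zeroʳ c)
Σₗ-*ˡ c f (x ∷ xs) = trans (cong (c * f x +_) (Σₗ-*ˡ c f xs)) (sym (*-distribˡ-+ c _ _))

Σₗ-0 : {A : Set} (xs : List A) → Σₗ (λ _ → 0) xs ≡ 0
Σₗ-0 []       = refl
Σₗ-0 (x ∷ xs) = Σₗ-0 xs

Σₗ-swap : {A B : Set} (f : A → B → ℕ) (xs : List A) (ys : List B) →
          Σₗ (λ x → Σₗ (f x) ys) xs ≡ Σₗ (λ y → Σₗ (λ x → f x y) xs) ys
Σₗ-swap f []       ys = sym (Σₗ-0 ys)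
Σₗ-swap f (x ∷ xs) ys = trans (cong (Σₗ (f x) ys +_) (Σₗ-swap f xs ys))
                              (sym (Σₗ-+ (f x) (λ y → Σₗ (λ x → f x y) xs) ys))

Σₗ-↭ : {A : Set} (f : A → ℕ) {xs ys : List A} → xs ↭ ys → Σₗ f xs ≡ Σₗ f ys
Σₗ-↭ f p = sum-↭ (map⁺ f p)

Σₗ-allFin-suc : ∀ {n} (f : Fin (suc n) → ℕ) → Σₗ f (tabulate suc) ≡ Σₗ (f ∘ suc) (allFin n)
Σₗ-allFin-suc f = cong sum (trans (map-tabulate suc f) (sym (map-tabulate (λ i → i) (f ∘ suc))))

bit : Bool → ℕ
bit true  = 1
bit false = 0

Σₗ-indicator : ∀ {n} (g : Fin n → ℕ) (u : Fin n) →
               Σₗ (λ y → g y * bit (does (u ≟ y))) (allFin n) ≡ g u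
Σₗ-indicator {suc n} g zero = begin
  g zero * 1 + Σₗ h (tabulate suc)                ≡⟨ cong (g zero * 1 +_) (Σₗ-allFin-suc h) ⟩
  g zero * 1 + Σₗ (λ y → g (suc y) * 0) (allFin n) ≡⟨ cong₂ _+_ (*-identityʳ (g zero))
    (Σₗ-cong (All.universal (λ y → *-zeroʳ (g (suc y))) (allFin n))) ⟩
  g zero + Σₗ (λ _ → 0) (allFin n)                ≡⟨ cong (g zero +_) (Σₗ-0 (allFin n)) ⟩
  g zero + 0                                      ≡⟨ +-identityʳ (g zero) ⟩
  g zero                                          ∎
  where
  open ≡-Reasoning
  h : Fin (suc n) → ℕ
  h y = g y * bit (does (zero ≟ y))
Σₗ-indicator {suc n} g (suc u) = begin
  g zero * 0 + Σₗ h (tabulate suc) ≡⟨ cong (_+ Σₗ h (tabulate suc)) (*-zeroʳ (g zero)) ⟩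
  Σₗ h (tabulate suc)              ≡⟨ Σₗ-allFin-suc h ⟩
  Σₗ (h ∘ suc) (allFin n)          ≡⟨ Σₗ-indicator (g ∘ suc) u ⟩
  g (suc u)                        ∎
  where
  open ≡-Reasoning
  h : Fin (suc n) → ℕ
  h y = g y * bit (does (suc u ≟ y))

-- Vertex sets and how a single edge crosses them.

VSet : ℕ → Set
VSet n = Fin n → Bool

module _ {n : ℕ} where

  _∩_ _∪_ _∖_ : VSet n → VSet n → VSet n
  (X ∩ Z) w = X w ∧ Z w
  (X ∪ Z) w = X w ∨ Z w
  (X ∖ Z) w = X w ∧ not (Z w)

  flip : Fin n → VSet n → VSet n
  flip y Z w = Z w xor does (w ≟ y)

  single : Fin n → VSet n
  single x w = does (w ≟ x)

  card : VSet n → ℕ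
  card X = Σₗ (bit ∘ X) (allFin n)

  card-< : ∀ {X Z : VSet n} (t : Fin n) → (∀ w → bit (X w) ≤ bit (Z w)) →
           X t ≡ false → Z t ≡ true → card X < card Z
  card-< {X} {Z} t le Xt Zt =
    Σₗ-mono-< le (Any.map (λ { refl → subst₂ _<_ (cong bit (sym Xt)) (cong bit (sym Zt)) (s≤s z≤n) })
                          (∈-allFin t))

  δ : VSet n → Fin n × Fin n → ℕ
  δ Z (u , w) = bit (Z u xor Z w)

-- Submodularity for one edge: `a` and `b` record whether its first end lies in each of two sets,
-- `c` and `d` do so for its second end. Summation over the edges carries it to cuts.
∩∪-submodular : ∀ a b c d → bit ((a ∧ b) xor (c ∧ d)) + bit ((a ∨ b) xor (c ∨ d))
                          ≤ bit (a xor c) + bit (b xor d)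
∩∪-submodular false false false false = z≤n
∩∪-submodular false false false true  = s≤s z≤n
∩∪-submodular false false true  false = s≤s z≤n
∩∪-submodular false false true  true  = s≤s (s≤s z≤n)
∩∪-submodular false true  false false = s≤s z≤n
∩∪-submodular false true  false true  = z≤n
∩∪-submodular false true  true  false = z≤n
∩∪-submodular false true  true  true  = s≤s z≤n
∩∪-submodular true  false false false = s≤s z≤n
∩∪-submodular true  false false true  = z≤n
∩∪-submodular true  false true  false = z≤n
∩∪-submodular true  false true  true  = s≤s z≤n
∩∪-submodular true  true  false false = s≤s (s≤s z≤n)
∩∪-submodular true  true  false true  = s≤s z≤n
∩∪-submodular true  true  true  false = s≤s z≤n
∩∪-submodular true  true  true  true  = z≤n

-- The companion inequality for differences, needed when the two sets belong to different terminals: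
-- their intersection then contains no terminal.
∖-submodular : ∀ a b c d → bit ((a ∧ not b) xor (c ∧ not d)) + bit ((b ∧ not a) xor (d ∧ not c))
                         ≤ bit (a xor c) + bit (b xor d)
∖-submodular false false false false = z≤n
∖-submodular false false false true  = s≤s z≤n
∖-submodular false false true  false = s≤s z≤n
∖-submodular false false true  true  = z≤n
∖-submodular false true  false false = s≤s z≤n
∖-submodular false true  false true  = z≤n
∖-submodular false true  true  false = s≤s (s≤s z≤n)
∖-submodular false true  true  true  = s≤s z≤n
∖-submodular true  false false false = s≤s z≤n
∖-submodular true  false false true  = s≤s (s≤s z≤n)
∖-submodular true  false true  false = z≤n
∖-submodular true  false true  true  = s≤s z≤n
∖-submodular true  true  false false = z≤n
∖-submodular true  true  false true  = s≤s z≤n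
∖-submodular true  true  true  false = s≤s z≤n
∖-submodular true  true  true  true  = z≤n

squeeze : ∀ {a b κ κ′} → a + b ≤ κ + κ′ → κ ≤ a → κ′ ≤ b → a ≡ κ
squeeze {a} {b} {κ} {κ′} le κ≤a κ′≤b =
  ≤-antisym (+-cancelʳ-≤ b a κ (≤-trans le (+-monoʳ-≤ κ κ′≤b))) κ≤a

-- With `a`, `b`, `c` the sides of `s`, `y`, `t`, this is the effect of splitting off at `y`: the
-- cut keeps its size, or loses two when `y` is separated from both neighbours.
split-bits : ∀ a b c → bit (a xor b) + bit (b xor c) ≡ bit (a xor c)
                     ⊎ a ≡ c × b ≡ not c × bit (a xor b) + bit (b xor c) ≡ 2 + bit (a xor c)
split-bits true  true  c     = inj₁ refl
split-bits false false c     = inj₁ refl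
split-bits true  false false = inj₁ refl
split-bits false true  true  = inj₁ refl
split-bits true  false true  = inj₂ (refl , refl , refl)
split-bits false true  false = inj₂ (refl , refl , refl)

-- Cuts and splitting off

module Splitting {n r : ℕ} (v : Fin r → Fin n) {A : Set} (ends : A → Fin n × Fin n) where

  cut : VSet n → List A → ℕ
  cut Z = Σₗ (δ Z ∘ ends)

  record Separates (i : Fin r) (Z : VSet n) : Set where
    constructor separates
    field at : ∀ j → Z (v j) ≡ does (j ≟ i)

  open Separates using (at)

  Linked : Fin n → Fin n → A → Set
  Linked y t f = ends f ≡ (y , t) ⊎ ends f ≡ (t , y)

  δ-linked : ∀ {y t f} Z → Linked y t f → δ Z (ends f) ≡ δ Z (y , t)
  δ-linked Z (inj₁ eq) rewrite eq = refl
  δ-linked {y} {t} Z (inj₂ eq) rewrite eq with Z y | Z t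
  ... | true  | true  = refl
  ... | true  | false = refl
  ... | false | true  = refl
  ... | false | false = refl

  cut-cong : ∀ {Z Z′} → (∀ w → Z w ≡ Z′ w) → ∀ L → cut Z L ≡ cut Z′ L
  cut-cong eq L = Σₗ-cong (All.universal (λ f → cong₂ (λ a b → bit (a xor b)) (eq _) (eq _)) L)

  ∩-separates : ∀ {i X Z} → Separates i X → Separates i Z → Separates i (X ∩ Z)
  ∩-separates (separates p) (separates q) =
    separates λ j → trans (cong₂ _∧_ (p j) (q j)) (∧-idem _)

  ∪-separates : ∀ {i X Z} → Separates i X → Separates i Z → Separates i (X ∪ Z)
  ∪-separates (separates p) (separates q) =
    separates λ j → trans (cong₂ _∨_ (p j) (q j)) (∨-idem _)

  ∖-separates : ∀ {i l X Z} → l ≢ i → Separates i X → Separates l Z → Separates i (X ∖ Z)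
  ∖-separates {i} {l} l≢i (separates p) (separates q) =
    separates λ j → trans (cong₂ (λ a b → a ∧ not b) (p j) (q j)) (lem j)
    where
    lem : ∀ j → does (j ≟ i) ∧ not (does (j ≟ l)) ≡ does (j ≟ i)
    lem j with j ≟ i | j ≟ l
    ... | yes refl | yes refl = contradiction refl l≢i
    ... | yes _    | no _     = refl
    ... | no _     | _        = refl

  flip-separates : ∀ {i Z y} → (∀ j → v j ≢ y) → Separates i Z → Separates i (flip y Z)
  flip-separates {Z = Z} {y} y∉ (separates p) =
    separates λ j → trans (cong (Z (v j) xor_) (dec-false (v j ≟ y) (y∉ j)))
                          (trans (xor-identityʳ _) (p j))

  single-separates : Injective _≡_ _≡_ v → ∀ i → Separates i (single (v i))
  single-separates v-inj i = separates at-single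
    where
    at-single : ∀ j → single (v i) (v j) ≡ does (j ≟ i)
    at-single j with v j ≟ v i | j ≟ i
    ... | yes _ | yes _    = refl
    ... | yes p | no j≢i   = contradiction (v-inj p) j≢i
    ... | no ¬p | yes refl = contradiction refl ¬p
    ... | no _  | no _     = refl

  submodular-∩∪ : ∀ X Z L → cut (X ∩ Z) L + cut (X ∪ Z) L ≤ cut X L + cut Z L
  submodular-∩∪ X Z L =
    subst₂ _≤_ (Σₗ-+ (δ (X ∩ Z) ∘ ends) (δ (X ∪ Z) ∘ ends) L) (Σₗ-+ (δ X ∘ ends) (δ Z ∘ ends) L)
      (Σₗ-mono (All.universal (λ f → ∩∪-submodular (X _) (Z _) (X _) (Z _)) L))

  submodular-∖ : ∀ X Z L → cut (X ∖ Z) L + cut (Z ∖ X) L ≤ cut X L + cut Z L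
  submodular-∖ X Z L =
    subst₂ _≤_ (Σₗ-+ (δ (X ∖ Z) ∘ ends) (δ (Z ∖ X) ∘ ends) L) (Σₗ-+ (δ X ∘ ends) (δ Z ∘ ends) L)
      (Σₗ-mono (All.universal (λ f → ∖-submodular (X _) (Z _) (X _) (Z _)) L))

  neighbour? : {P : Fin n → Set} → Decidable P → ∀ y f →
               (∃[ t ] P t × Linked y t f) ⊎ (∀ t → Linked y t f → ¬ P t)
  neighbour? P? y f with (proj₁ (ends f) ≟ y) ×-dec P? (proj₂ (ends f))
                       | (proj₂ (ends f) ≟ y) ×-dec P? (proj₁ (ends f))
  ... | yes (refl , p) | _              = inj₁ (_ , p , inj₁ refl)
  ... | no _           | yes (refl , p) = inj₁ (_ , p , inj₂ refl)
  ... | no ¬p          | no ¬q          =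
    inj₂ λ { t (inj₁ refl) Pt → ¬p (refl , Pt) ; t (inj₂ refl) Pt → ¬q (refl , Pt) }

  neighbours? : {P : Fin n → Set} → Decidable P → ∀ y L →
                (∃[ t ] P t × Any (Linked y t) L) ⊎ All (λ f → ∀ t → Linked y t f → ¬ P t) L
  neighbours? P? y []      = inj₂ []
  neighbours? P? y (f ∷ L) with neighbour? P? y f | neighbours? P? y L
  ... | inj₁ (t , p , l) | _                = inj₁ (t , p , here l)
  ... | inj₂ _           | inj₁ (t , p , l) = inj₁ (t , p , there l)
  ... | inj₂ q           | inj₂ qs          = inj₂ (q ∷ qs)

  -- Moving `y` across can make an edge cross only when it joins `y` to another vertex on the old
  -- side of `y`. Loops at `y` never cross, hence the clause `t ≢ y`.
  δ-flip-≤ : ∀ y Z f → (∀ t → Linked y t f → ¬ (Z t ≡ Z y × t ≢ y)) →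
             δ (flip y Z) (ends f) ≤ δ Z (ends f)
  δ-flip-≤ y Z f none with ends f
  ... | a , b with a ≟ y | b ≟ y
  ... | yes refl | yes refl with Z a
  ...   | true  = z≤n
  ...   | false = z≤n
  δ-flip-≤ y Z f none | a , b | yes refl | no b≢y with Z b in eqb | Z a
  ...   | true  | true  = contradiction (eqb , b≢y) (none b (inj₁ refl))
  ...   | true  | false = z≤n
  ...   | false | true  = z≤n
  ...   | false | false = contradiction (eqb , b≢y) (none b (inj₁ refl))
  δ-flip-≤ y Z f none | a , b | no a≢y | yes refl with Z a in eqa | Z b
  ...   | true  | true  = contradiction (eqa , a≢y) (none a (inj₂ refl))
  ...   | true  | false = z≤n
  ...   | false | true  = z≤n
  ...   | false | false = contradiction (eqa , a≢y) (none a (inj₂ refl))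
  δ-flip-≤ y Z f none | a , b | no _ | no _ with Z a | Z b
  ...   | true  | true  = z≤n
  ...   | true  | false = s≤s z≤n
  ...   | false | true  = s≤s z≤n
  ...   | false | false = z≤n

  -- An edge that misses `y` or is a loop there does not notice the move.
  δ-flip-≡ : ∀ y Z f → (∀ t → Linked y t f → ¬ (t ≢ y)) →
             δ (flip y Z) (ends f) ≡ δ Z (ends f)
  δ-flip-≡ y Z f none with ends f
  ... | a , b with a ≟ y | b ≟ y
  ... | yes refl | yes refl with Z a
  ...   | true  = refl
  ...   | false = refl
  δ-flip-≡ y Z f none | a , b | yes refl | no b≢y = contradiction b≢y (none b (inj₁ refl))
  δ-flip-≡ y Z f none | a , b | no a≢y | yes refl = contradiction a≢y (none a (inj₂ refl))
  δ-flip-≡ y Z f none | a , b | no _ | no _ with Z a | Z b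
  ...   | true  | true  = refl
  ...   | true  | false = refl
  ...   | false | true  = refl
  ...   | false | false = refl

  module _ (κ : Fin r → ℕ) where

    -- Encodes the lower bound κ i on the cut and its parity at once.
    record Inv (L : List A) : Set where
      constructor mkInv
      field excess : ∀ {i Z} → Separates i Z → ∃[ c ] cut Z L ≡ κ i + c * 2

    open Inv

    -- Tight cuts attain the minimum that `Inv` allows, so they are the ones that cannot afford to
    -- lose two edges.
    record Tight (i : Fin r) (Z : VSet n) (L : List A) : Set where
      constructor tight
      field
        sep   : Separates i Z
        equal : cut Z L ≡ κ i

    open Tight

    -- Splitting the edges s–y and y–t into one edge s–t lowers the cut of Z by two exactly
    -- when Z separates y from both s and t; this is harmful only for tight Z.
    record Bad (L : List A) (s y t : Fin n) (Z : VSet n) : Set where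
      constructor mkBad
      field
        {index} : Fin r
        isTight : Tight index Z L
        s≡t     : Z s ≡ Z t
        y≡¬t    : Z y ≡ not (Z t)

    bad? : ∀ L s y t → Decidable (Bad L s y t)
    bad? L s y t Z
      with any? (λ j → all? (λ i → Z (v i) Bool.≟ does (i ≟ j)) ×-dec (cut Z L ℕ.≟ κ j))
         | Z s Bool.≟ Z t | Z y Bool.≟ not (Z t)
    ... | yes (j , p , q) | yes eq | yes eq′ = yes (mkBad (tight (separates p) q) eq eq′)
    ... | no ¬p           | _      | _       = no λ (mkBad (tight (separates p) q) _ _) → ¬p (_ , p , q)
    ... | yes _           | no ¬eq | _       = no λ bad → ¬eq (Bad.s≡t bad)
    ... | yes _           | yes _  | no ¬eq  = no λ bad → ¬eq (Bad.y≡¬t bad)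

    -- The search that follows runs over bit vectors, which agree with a vertex set only pointwise.
    Bad-cong : ∀ {L s y t Z Z′} → (∀ w → Z w ≡ Z′ w) → Bad L s y t Z → Bad L s y t Z′
    Bad-cong {L} {s} {y} {t} eq (mkBad (tight (separates p) q) s≡t y≡¬t) = mkBad
      (tight (separates λ i → trans (sym (eq (v i))) (p i)) (trans (sym (cut-cong eq L)) q))
      (trans (sym (eq s)) (trans s≡t (eq t)))
      (trans (sym (eq y)) (trans y≡¬t (cong not (eq t))))

    anyBad? : ∀ L s y t → Dec (∃ (Bad L s y t))
    anyBad? L s y t with anySubset? (λ S → bad? L s y t (Vec.lookup S))
    ... | yes (S , bad) = yes (_ , bad)
    ... | no none       = no λ (Z , bad) →
      none (Vec.tabulate Z , Bad-cong (λ w → sym (lookup∘tabulate Z w)) bad)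

    Inv⇒≤ : ∀ {L} → Inv L → ∀ {i Z} → Separates i Z → κ i ≤ cut Z L
    Inv⇒≤ inv {i} sep with excess inv sep
    ... | c , eq = subst (κ i ≤_) (sym eq) (m≤m+n (κ i) (c * 2))

    -- Intersection and union separate the same terminal, so each has at least `κ i` crossing edges,
    -- and submodularity leaves no room for more.
    ∩∪-tight : ∀ {L} → Inv L → ∀ {i X Z} → Tight i X L → Tight i Z L →
               Tight i (X ∩ Z) L × Tight i (X ∪ Z) L
    ∩∪-tight {L} inv {i} {X} {Z} (tight p P) (tight q Q) =
      tight p∩q (squeeze le (Inv⇒≤ inv p∩q) (Inv⇒≤ inv p∪q)) ,
      tight p∪q (squeeze (subst (_≤ κ i + κ i) (+-comm (cut (X ∩ Z) L) _) le)
                         (Inv⇒≤ inv p∪q) (Inv⇒≤ inv p∩q))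
      where
      p∩q : Separates i (X ∩ Z)
      p∩q = ∩-separates p q
      p∪q : Separates i (X ∪ Z)
      p∪q = ∪-separates p q
      le : cut (X ∩ Z) L + cut (X ∪ Z) L ≤ κ i + κ i
      le = subst₂ (λ a b → cut (X ∩ Z) L + cut (X ∪ Z) L ≤ a + b) P Q (submodular-∩∪ X Z L)

    -- Each set lacks the terminal of the other, so both differences still separate their own
    -- terminals, and the inequality for differences leaves no slack.
    ∖-tight : ∀ {L} → Inv L → ∀ {i j X Z} → j ≢ i → Tight i X L → Tight j Z L → Tight i (X ∖ Z) L
    ∖-tight {L} inv {i} {j} {X} {Z} j≢i (tight p P) (tight q Q) = tight p∖q
      (squeeze (subst₂ (λ a b → cut (X ∖ Z) L + cut (Z ∖ X) L ≤ a + b) P Q (submodular-∖ X Z L))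
               (Inv⇒≤ inv p∖q) (Inv⇒≤ inv (∖-separates (j≢i ∘ sym) q p)))
      where
      p∖q : Separates i (X ∖ Z)
      p∖q = ∖-separates j≢i p q

    module _ {e : A} {L : List A} (inv : Inv (e ∷ L)) {i₀ : Fin r} {y : Fin n}
             (y∉ : ∀ j → v j ≢ y) (link : Linked (v i₀) y e) where

      private
        s : Fin n
        s = v i₀
        L⁺ : List A
        L⁺ = e ∷ L

      Splittable : Set
      Splittable = ∃[ t ] Any (Linked y t) L × ¬ ∃ (Bad L⁺ s y t)

      δ-e : ∀ Z a b → Z s ≡ a → Z y ≡ b → δ Z (ends e) ≡ bit (a xor b)
      δ-e Z a b p q = trans (δ-linked Z link) (cong₂ (λ a b → bit (a xor b)) p q)

      flip-s : ∀ Z → flip y Z s ≡ Z s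
      flip-s Z rewrite dec-false (s ≟ y) (y∉ i₀) with Z s
      ... | true  = refl
      ... | false = refl

      flip-y : ∀ Z → flip y Z y ≡ not (Z y)
      flip-y Z rewrite dec-true (y ≟ y) refl with Z y
      ... | true  = refl
      ... | false = refl

      δ-e-flip : ∀ Z → Z s ≡ not (Z y) → δ (flip y Z) (ends e) ≡ 0 × δ Z (ends e) ≡ 1
      δ-e-flip Z ne = trans (δ-e (flip y Z) _ _ (flip-s Z) (flip-y Z)) (lem (Z s) (Z y) ne) ,
                      trans (δ-e Z _ _ refl refl) (lem′ (Z s) (Z y) ne)
        where
        lem : ∀ a b → a ≡ not b → bit (a xor not b) ≡ 0
        lem a true  refl = refl
        lem a false refl = refl
        lem′ : ∀ a b → a ≡ not b → bit (a xor b) ≡ 1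
        lem′ a true  refl = refl
        lem′ a false refl = refl

      -- Without such a `t`, moving `y` across would uncross `e` and make no other edge cross, so a
      -- set separating `v i` would fall below `κ i`.
      inner-neighbour : ∀ {i Z} → Tight i Z L⁺ → Z s ≡ not (Z y) →
                        ∃[ t ] (Z t ≡ Z y × t ≢ y) × Any (Linked y t) L
      inner-neighbour {i} {Z} (tight sep eq) ne
        with neighbours? (λ t → (Z t Bool.≟ Z y) ×-dec ¬? (t ≟ y)) y L
      ... | inj₁ found = found
      ... | inj₂ none  = contradiction (Inv⇒≤ inv (flip-separates y∉ sep)) (<⇒≱ lt)
        where
        lt : cut (flip y Z) L⁺ < κ i
        lt = subst (cut (flip y Z) L⁺ <_) eq
               (+-mono-<-≤ (subst₂ _<_ (sym (proj₁ (δ-e-flip Z ne))) (sym (proj₂ (δ-e-flip Z ne))) (s≤s z≤n))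
                           (Σₗ-mono (All.map (λ {f} → δ-flip-≤ y Z f) none)))

      -- A neighbour t of y inside a smallest tight set X containing y but not s works: a bad set Z
      -- uncrosses with X to the smaller X ∩ Z or X ∖ Z, or e joins X ∩ Z to the outside of X ∪ Z,
      -- which submodularity forbids.
      descend : ∀ {j} X → j ≢ i₀ → Tight j X L⁺ → X y ≡ true → Acc _<_ (card X) → Splittable
      descend {j} X j≢i₀ tX@(tight (separates sX) _) Xy (acc rec)
        with inner-neighbour tX Xs≡
        where
        Xs≡ : X s ≡ not (X y)
        Xs≡ = trans (sX i₀) (trans (dec-false (i₀ ≟ j) (j≢i₀ ∘ sym)) (cong not (sym Xy)))
      ... | t , (Xt≡ , _) , linked with anyBad? L⁺ s y t
      ... | no ok = t , linked , ok
      ... | yes (Z , mkBad {l} tZ@(tight (separates sZ) _) Zs≡Zt Zy≡) with l ≟ j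
      -- `Z` misses `s`, hence also `t`, and contains `y`: the intersection keeps `y` and loses `t`,
      -- so the recursion terminates.
      ...   | yes refl = descend (X ∩ Z) j≢i₀ (proj₁ (∩∪-tight inv tX tZ)) (cong₂ _∧_ Xy Zy)
                           (rec (card-< t ∩-≤ (cong₂ _∧_ Xt Zt) Xt))
        where
        Xt : X t ≡ true
        Xt = trans Xt≡ Xy
        Zt : Z t ≡ false
        Zt = trans (sym Zs≡Zt) (trans (sZ i₀) (dec-false (i₀ ≟ j) (j≢i₀ ∘ sym)))
        Zy : Z y ≡ true
        Zy = trans Zy≡ (cong not Zt)
        ∩-≤ : ∀ w → bit (X w ∧ Z w) ≤ bit (X w)
        ∩-≤ w with X w | Z w
        ... | true  | true  = ≤-refl
        ... | true  | false = z≤n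
        ... | false | _     = z≤n
      ...   | no l≢j with l ≟ i₀
      -- `Z` contains `s`, hence `t`, and misses `y`: now the difference keeps `y` and loses `t`.
      ...     | yes refl = descend (X ∖ Z) j≢i₀ (∖-tight inv l≢j tX tZ) (cong₂ (λ a b → a ∧ not b) Xy Zy)
                             (rec (card-< t ∖-≤ (cong₂ (λ a b → a ∧ not b) Xt Zt) Xt))
        where
        Xt : X t ≡ true
        Xt = trans Xt≡ Xy
        Zt : Z t ≡ true
        Zt = trans (sym Zs≡Zt) (trans (sZ i₀) (dec-true (i₀ ≟ i₀) refl))
        Zy : Z y ≡ false
        Zy = trans Zy≡ (cong not Zt)
        ∖-≤ : ∀ w → bit (X w ∧ not (Z w)) ≤ bit (X w)
        ∖-≤ w with X w | Z w
        ... | true  | true  = z≤n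
        ... | true  | false = ≤-refl
        ... | false | _     = z≤n
      ...     | no l≢i₀ = contradiction
                 (+-mono-≤ (Inv⇒≤ inv (∖-separates l≢j (sep tX) (sep tZ)))
                           (Inv⇒≤ inv (∖-separates (l≢j ∘ sym) (sep tZ) (sep tX))))
                 (<⇒≱ lt)
        where
        Xs : X s ≡ false
        Xs = trans (sX i₀) (dec-false (i₀ ≟ j) (j≢i₀ ∘ sym))
        Zs : Z s ≡ false
        Zs = trans (sZ i₀) (dec-false (i₀ ≟ l) (l≢i₀ ∘ sym))
        Zy : Z y ≡ true
        Zy = trans Zy≡ (cong not (trans (sym Zs≡Zt) Zs))
        diff : ∀ {a a′ b b′} → a ≡ a′ → b ≡ b′ → a ∧ not b ≡ a′ ∧ not b′
        diff = cong₂ (λ a b → a ∧ not b)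
        -- `y` lies in both sets and `s` in neither, so `e` crosses each set but neither difference.
        strict : δ (X ∖ Z) (ends e) + δ (Z ∖ X) (ends e) < δ X (ends e) + δ Z (ends e)
        strict = subst₂ _<_
          (sym (cong₂ _+_ (δ-e (X ∖ Z) false false (diff Xs Zs) (diff Xy Zy))
                          (δ-e (Z ∖ X) false false (diff Zs Xs) (diff Zy Xy))))
          (sym (cong₂ _+_ (δ-e X false true Xs Xy) (δ-e Z false true Zs Zy)))
          (s≤s z≤n)
        lt : cut (X ∖ Z) L⁺ + cut (Z ∖ X) L⁺ < κ j + κ l
        lt = subst₂ _<_
          (+-interchange (δ (X ∖ Z) (ends e)) (δ (Z ∖ X) (ends e)) (cut (X ∖ Z) L) (cut (Z ∖ X) L))
          (trans (+-interchange (δ X (ends e)) (δ Z (ends e)) (cut X L) (cut Z L))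
                 (cong₂ _+_ (equal tX) (equal tZ)))
          (+-mono-<-≤ strict (submodular-∖ X Z L))

      -- A bad set of another terminal misses `s`, and `y` lies opposite to `s`; such a set can
      -- serve as the start of `descend`.
      bad⇒y∈ : ∀ {l Z t} → l ≢ i₀ → Tight l Z L⁺ → Z s ≡ Z t → Z y ≡ not (Z t) → Z y ≡ true
      bad⇒y∈ {l} l≢i₀ (tight (separates sZ) _) Zs≡Zt Zy≡ =
        trans Zy≡ (cong not (trans (sym Zs≡Zt) (trans (sZ i₀) (dec-false (i₀ ≟ l) (l≢i₀ ∘ sym)))))

      -- Dually, t is taken outside a largest tight set W containing s but not y.
      ascend : ∀ W → Tight i₀ W L⁺ → W y ≡ false → Acc _<_ (card (not ∘ W)) → Splittable
      ascend W tW@(tight (separates sW) _) Wy (acc rec)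
        with inner-neighbour tW (trans (sW i₀) (trans (dec-true (i₀ ≟ i₀) refl) (cong not (sym Wy))))
      ... | t , (Wt≡ , _) , linked with anyBad? L⁺ s y t
      ... | no ok = t , linked , ok
      ... | yes (Z , mkBad {l} tZ@(tight (separates sZ) _) Zs≡Zt Zy≡) with l ≟ i₀
      ...   | no l≢i₀ = descend Z l≢i₀ tZ (bad⇒y∈ l≢i₀ tZ Zs≡Zt Zy≡) (<-wellFounded _)
      -- `Z` contains `t` and misses `y`: the union gains `t`, so its complement shrinks.
      ...   | yes refl = ascend (W ∪ Z) (proj₂ (∩∪-tight inv tW tZ)) (cong₂ _∨_ Wy Zy)
                           (rec (card-< t ∪-≤ (cong not (cong₂ _∨_ Wt Zt)) (cong not Wt)))
        where
        Wt : W t ≡ false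
        Wt = trans Wt≡ Wy
        Zt : Z t ≡ true
        Zt = trans (sym Zs≡Zt) (trans (sZ i₀) (dec-true (i₀ ≟ i₀) refl))
        Zy : Z y ≡ false
        Zy = trans Zy≡ (cong not Zt)
        ∪-≤ : ∀ w → bit (not (W w ∨ Z w)) ≤ bit (not (W w))
        ∪-≤ w with W w | Z w
        ... | true  | _     = z≤n
        ... | false | true  = z≤n
        ... | false | false = ≤-refl

      module _ (v-inj : Injective _≡_ _≡_ v) where

        -- By parity: if `e` were the only non-loop edge at `y`, adding `y` to the singleton of `s`
        -- would change the cut by exactly one, but both cuts differ from `κ i₀` by an even number.
        some-neighbour : ∃[ t ] (t ≢ y) × Any (Linked y t) L
        some-neighbour with neighbours? (λ t → ¬? (t ≟ y)) y L
        ... | inj₁ found = found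
        ... | inj₂ none
          with excess inv (single-separates v-inj i₀)
             | excess inv (flip-separates y∉ (single-separates v-inj i₀))
        ... | c , eq | c′ , eq′ = contradiction odd (parity (κ i₀) c c′)
          where
          ne : single s s ≡ not (single s y)
          ne = trans (dec-true (s ≟ s) refl) (cong not (sym (dec-false (y ≟ s) (y∉ i₀ ∘ sym))))
          odd : κ i₀ + c * 2 ≡ suc (κ i₀ + c′ * 2)
          odd = trans (sym eq) (trans
            (cong₂ _+_ (proj₂ (δ-e-flip (single s) ne))
                       (sym (Σₗ-cong (All.map (λ {f} → δ-flip-≡ y (single s) f) none))))
            (cong suc (trans (sym (cong (_+ cut (flip y (single s)) L)
                                        (proj₁ (δ-e-flip (single s) ne)))) eq′)))
          parity : ∀ k c c′ → k + c * 2 ≢ suc (k + c′ * 2)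
          parity (suc k) c c′ p = parity k c c′ (suc-injective p)
          parity zero (suc c) (suc c′) p = parity zero c c′ (suc-injective (suc-injective p))
          parity zero zero c′ ()
          parity zero (suc c) zero ()

        -- Any neighbour is tried first. If it fails, the bad set that shows this is the seed: it
        -- belongs to another terminal and starts `descend`, or belongs to `s` and starts `ascend`.
        splittable : Splittable
        splittable with some-neighbour
        ... | t , _ , linked with anyBad? L⁺ s y t
        ... | no ok = t , linked , ok
        ... | yes (Z , mkBad {l} tZ@(tight (separates sZ) _) Zs≡Zt Zy≡) with l ≟ i₀
        ...   | no l≢i₀ = descend Z l≢i₀ tZ (bad⇒y∈ l≢i₀ tZ Zs≡Zt Zy≡) (<-wellFounded _)
        ...   | yes refl = ascend Z tZ
                  (trans Zy≡ (cong not (trans (sym Zs≡Zt) (trans (sZ i₀) (dec-true (i₀ ≟ i₀) refl)))))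
                  (<-wellFounded _)

    -- A cut that loses two edges separates `y` from `s` and `t`. It is not tight, since it would
    -- then be bad, so its excess over `κ i` is positive and can drop by two.
    Inv-split : ∀ {e f g L s y t} → Inv (e ∷ f ∷ L) →
                Linked s y e → Linked y t f → Linked s t g →
                ¬ ∃ (Bad (e ∷ f ∷ L) s y t) → Inv (g ∷ L)
    Inv-split {e} {f} {g} {L} {s} {y} {t} inv le lf lg ok .excess {i} {Z} sep
      with excess inv sep
    ... | c , eq with split-bits (Z s) (Z y) (Z t)
    ...   | inj₁ same = c , trans (cong (_+ cut Z L) (trans (δ-linked Z lg) (sym same))) (trans (sym cut-old) eq)
      where
      cut-old : cut Z (e ∷ f ∷ L) ≡ (bit (Z s xor Z y) + bit (Z y xor Z t)) + cut Z L
      cut-old = trans (cong₂ (λ a b → a + (b + cut Z L)) (δ-linked Z le) (δ-linked Z lf))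
                      (sym (+-assoc (bit (Z s xor Z y)) _ _))
    ...   | inj₂ (p , q , drop) with c
    ...     | zero   = contradiction (Z , mkBad (tight sep (trans eq (+-identityʳ (κ i)))) p q) ok
    ...     | suc c′ = c′ , +-cancelˡ-≡ 2 _ _ (begin
      2 + (δ Z (ends g) + cut Z L)                       ≡⟨ cong (λ a → 2 + (a + cut Z L)) (δ-linked Z lg) ⟩
      2 + bit (Z s xor Z t) + cut Z L                    ≡⟨ cong (_+ cut Z L) (sym drop) ⟩
      bit (Z s xor Z y) + bit (Z y xor Z t) + cut Z L    ≡⟨ +-assoc (bit (Z s xor Z y)) _ _ ⟩
      bit (Z s xor Z y) + (bit (Z y xor Z t) + cut Z L)  ≡⟨ cong₂ (λ a b → a + (b + cut Z L))
                                                                  (sym (δ-linked Z le)) (sym (δ-linked Z lf)) ⟩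
      cut Z (e ∷ f ∷ L)                                  ≡⟨ eq ⟩
      κ i + (2 + c′ * 2)                                 ≡⟨ sym (+-assoc (κ i) 2 _) ⟩
      (κ i + 2) + c′ * 2                                 ≡⟨ cong (_+ c′ * 2) (+-comm (κ i) 2) ⟩
      2 + (κ i + c′ * 2)                                 ∎)
      where open ≡-Reasoning

    Inv-↭ : ∀ {L L′} → L ↭ L′ → Inv L → Inv L′
    Inv-↭ p inv .excess {Z = Z} sep with excess inv sep
    ... | c , eq = c , trans (sym (Σₗ-↭ (δ Z ∘ ends) p)) eq

    Bad-↭ : ∀ {L L′ s y t} → L ↭ L′ → ∃ (Bad L s y t) → ∃ (Bad L′ s y t)
    Bad-↭ p (Z , mkBad (tight sep eq) q q′) =
      Z , mkBad (tight sep (trans (sym (Σₗ-↭ (δ Z ∘ ends) p)) eq)) q q′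

extract : {A : Set} {P : A → Set} {xs : List A} → Any P xs →
          ∃[ x ] ∃[ ys ] P x × xs ↭ x ∷ ys
extract (here p)  = _ , _ , p , ↭-refl
extract (there {x = z} a) with extract a
... | x , ys , p , σ = x , z ∷ ys , p , ↭-trans (↭.prep z σ) (↭.swap z x ↭-refl)

-- Replacing edges by trails

module Trails (G : Graph) where

  -- An edge of the current multigraph together with the walk in `G` that it stands for.
  -- Distinctness of edges is not demanded here: it follows at the end, because the combined
  -- `support` is preserved up to order.
  record Trail : Set where
    field
      {source target} : Fin (n G)
      {steps}         : List (Fin (m G))
      route           : Walk G source target steps

  open Trail public

  ends : Trail → Fin (n G) × Fin (n G)
  ends T = source T , target T

  support : List Trail → List (Fin (m G))
  support = concatMap steps

  support-↭ : ∀ {L L′} → L ↭ L′ → support L ↭ support L′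
  support-↭ ↭.refl            = ↭-refl
  support-↭ (↭.prep T σ)      = ++⁺ˡ (steps T) (support-↭ σ)
  support-↭ (↭.swap T U σ) =
    ↭-trans (shifts (steps T) (steps U)) (++⁺ˡ (steps U) (++⁺ˡ (steps T) (support-↭ σ)))
  support-↭ (↭.trans σ τ)     = ↭-trans (support-↭ σ) (support-↭ τ)

  _++ʷ_ : ∀ {u w x es fs} → Walk G u w es → Walk G w x fs → Walk G u x (es ++ fs)
  nil        ++ʷ q = q
  cons e j p ++ʷ q = cons e j (p ++ʷ q)

  reverseʷ : ∀ {u w es} → Walk G u w es → ∃[ fs ] Walk G w u fs × fs ↭ es
  reverseʷ nil = [] , nil , ↭-refl
  reverseʷ (cons e j p) with reverseʷ p
  ... | fs , q , σ = fs ++ e ∷ [] , q ++ʷ cons e (swap j) nil ,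
                     ↭-trans (↭-sym (∷↭∷ʳ e fs)) (↭.prep e σ)

  module _ {r : ℕ} (v : Fin r → Fin (n G)) where
    open Splitting v ends

    orient : ∀ {a b} T → Linked a b T → ∃[ es ] Walk G a b es × es ↭ steps T
    orient T (inj₁ refl) = steps T , route T , ↭-refl
    orient T (inj₂ refl) = reverseʷ (route T)

    -- Trails between two non-terminals are also pure. They add nothing to the degree of a terminal
    -- and can be left over.
    Pure : Trail → Set
    Pure T = ∀ i y → Linked (v i) y T → ∃[ j ] v j ≡ y

    pure? : ∀ T → (∃[ i ] ∃[ y ] Linked (v i) y T × (∀ j → v j ≢ y)) ⊎ Pure T
    pure? T with any? (λ j → v j ≟ source T) | any? (λ j → v j ≟ target T)
    ... | yes p          | yes q          = inj₂ λ { i y (inj₁ refl) → q ; i y (inj₂ refl) → p }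
    ... | yes (i , refl) | no ¬q          = inj₁ (i , target T , inj₁ refl , λ j eq → ¬q (j , eq))
    ... | no ¬p          | yes (i , refl) = inj₁ (i , source T , inj₂ refl , λ j eq → ¬p (j , eq))
    ... | no ¬p          | no ¬q          =
      inj₂ λ { i y (inj₁ refl) → contradiction (i , refl) ¬p ; i y (inj₂ refl) → contradiction (i , refl) ¬q }

    allPure? : ∀ L → Any (λ T → ∃[ i ] ∃[ y ] Linked (v i) y T × (∀ j → v j ≢ y)) L ⊎ All Pure L
    allPure? []      = inj₂ []
    allPure? (T ∷ L) with pure? T | allPure? L
    ... | inj₁ p | _       = inj₁ (here p)
    ... | inj₂ _ | inj₁ ps = inj₁ (there ps)
    ... | inj₂ p | inj₂ ps = inj₂ (p ∷ ps)

    -- Every splitting off turns two trails into one, so the number of trails decreases;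
    -- concatenation preserves the support up to order.
    purify : Injective _≡_ _≡_ v → (κ : Fin r → ℕ) → ∀ L → Acc _<_ (length L) → Inv κ L →
             ∃[ L′ ] Inv κ L′ × All Pure L′ × support L ↭ support L′
    purify v-inj κ L (acc rec) inv with allPure? L
    ... | inj₂ pure = L , inv , pure , ↭-refl
    ... | inj₁ mixed with extract mixed
    ... | e , L₁ , (i , y , e-link , y∉) , σ with splittable κ (Inv-↭ κ σ inv) y∉ e-link v-inj
    ... | t , found , ok with extract found
    ... | f , L₂ , f-link , τ with orient e e-link | orient f f-link
    ... | es , p , es↭ | fs , q , fs↭
      with purify v-inj κ (g ∷ L₂) (rec shorter)
             (Inv-split κ (Inv-↭ κ σ′ inv) e-link f-link (inj₁ refl) (ok ∘ Bad-↭ κ (↭-sym (↭.prep e τ))))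
      where
      g : Trail
      g = record { route = p ++ʷ q }
      σ′ : L ↭ e ∷ f ∷ L₂
      σ′ = ↭-trans σ (↭.prep e τ)
      shorter : suc (length L₂) < length L
      shorter = ≤-reflexive (sym (↭-length σ′))
    ... | L′ , inv′ , pure , π = L′ , inv′ , pure , (begin
      support L                              ↭⟨ support-↭ (↭-trans σ (↭.prep e τ)) ⟩
      steps e ++ steps f ++ support L₂       ↭⟨ ++⁺ (↭-sym es↭) (++⁺ʳ _ (↭-sym fs↭)) ⟩
      es ++ fs ++ support L₂                 ≡⟨ sym (++-assoc es fs _) ⟩
      (es ++ fs) ++ support L₂               ↭⟨ π ⟩
      support L′                             ∎)
      where open PermutationReasoning

  -- Four terminals

  module FourTerminals (v : Fin 4 → Fin (n G)) (v-inj : Injective _≡_ _≡_ v) where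
    open Splitting v ends

    record Join : Set where
      constructor mkJoin
      field
        pairing : Pairing
        {es fs} : List (Fin (m G))
        first   : Walk G (v (proj₁ (pair pairing zero))) (v (proj₂ (pair pairing zero))) es
        second  : Walk G (v (proj₁ (pair pairing (suc zero)))) (v (proj₂ (pair pairing (suc zero)))) fs

      edgesOf : List (Fin (m G))
      edgesOf = es ++ fs

    open Join

    -- `[]` discards whatever edges remain. On a list without repetitions, the permutations make all
    -- chosen walks edge-disjoint and free of repeated edges.
    data Packing : ℕ → List (Fin (m G)) → Set where
      []   : ∀ {es} → Packing 0 es
      _⟨_⟩∷_ : ∀ {k es es′} (J : Join) → es ↭ edgesOf J ++ es′ → Packing k es′ → Packing (suc k) es

    Packing-↭ : ∀ {k es es′} → es ↭ es′ → Packing k es′ → Packing k es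
    Packing-↭ σ []             = []
    Packing-↭ σ (J ⟨ τ ⟩∷ Js) = J ⟨ ↭-trans σ τ ⟩∷ Js

    -- The degree of the terminal among the trails, closed trails not counted.
    degᵗ : Fin 4 → List Trail → ℕ
    degᵗ i = cut (single (v i))

    single-at : ∀ i j → single (v i) (v j) ≡ does (j ≟ i)
    single-at i = Separates.at (single-separates v-inj i)

    δ-single : ∀ {a b T} i → Linked (v a) (v b) T →
               δ (single (v i)) (ends T) ≡ bit (does (a ≟ i) xor does (b ≟ i))
    δ-single {a} {b} {T} i l = trans (δ-linked {f = T} (single (v i)) l)
                                 (cong₂ (λ a b → bit (a xor b)) (single-at i a) (single-at i b))

    linked? : ∀ a b T → Dec (Linked (v a) (v b) T)
    linked? a b T = ≡-dec _≟_ _≟_ (ends T) (v a , v b) ⊎-dec ≡-dec _≟_ _≟_ (ends T) (v b , v a)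

    Linked-unique : ∀ {a b c d T} → Linked (v a) (v b) T → Linked (v c) (v d) T →
                    (a ≡ c × b ≡ d) ⊎ (a ≡ d × b ≡ c)
    Linked-unique (inj₁ p) (inj₁ q) with trans (sym p) q
    ... | eq = inj₁ (v-inj (cong proj₁ eq) , v-inj (cong proj₂ eq))
    Linked-unique (inj₁ p) (inj₂ q) with trans (sym p) q
    ... | eq = inj₂ (v-inj (cong proj₁ eq) , v-inj (cong proj₂ eq))
    Linked-unique (inj₂ p) (inj₁ q) with trans (sym p) q
    ... | eq = inj₂ (v-inj (cong proj₂ eq) , v-inj (cong proj₁ eq))
    Linked-unique (inj₂ p) (inj₂ q) with trans (sym p) q
    ... | eq = inj₁ (v-inj (cong proj₂ eq) , v-inj (cong proj₁ eq))

    Missing : Fin 4 → Fin 4 → List Trail → Set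
    Missing a b = All (λ T → ¬ Linked (v a) (v b) T)

    Missing-sym : ∀ {a b L} → Missing a b L → Missing b a L
    Missing-sym = All.map (λ ¬l l → ¬l (swap l))

    LinkedPair : Pairing → Fin 2 → Trail → Set
    LinkedPair π q = Linked (v (proj₁ (pair π q))) (v (proj₂ (pair π q)))

    -- Removing a trail for the first pair never removes one for the second, so a failed search in
    -- the remainder is a failure in the whole list.
    pairs-disjoint : ∀ π {T} → LinkedPair π zero T → ¬ LinkedPair π (suc zero) T
    pairs-disjoint π {T} l l′ with Linked-unique {T = T} l l′
    pairs-disjoint 12∣34 l l′ | inj₁ (() , _)
    pairs-disjoint 12∣34 l l′ | inj₂ (() , _)
    pairs-disjoint 13∣24 l l′ | inj₁ (() , _)
    pairs-disjoint 13∣24 l l′ | inj₂ (() , _)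
    pairs-disjoint 14∣23 l l′ | inj₁ (() , _)
    pairs-disjoint 14∣23 l l′ | inj₂ (() , _)

    matching? : ∀ π L →
      (∃[ e ] ∃[ f ] ∃[ L′ ] LinkedPair π zero e × LinkedPair π (suc zero) f × L ↭ e ∷ f ∷ L′)
      ⊎ (∃[ q ] Missing (proj₁ (pair π q)) (proj₂ (pair π q)) L)
    matching? π L with Any.any? (linked? _ _) L
    ... | no none = inj₂ (zero , All.¬Any⇒All¬ L none)
    ... | yes found with extract found
    ... | e , L₁ , e-link , σ with Any.any? (linked? _ _) L₁
    ... | no none    = inj₂ (suc zero , All-resp-↭ (↭-sym σ) (pairs-disjoint π {e} e-link ∷ All.¬Any⇒All¬ L₁ none))
    ... | yes found′ with extract found′
    ... | f , L′ , f-link , τ = inj₁ (e , f , L′ , e-link , f-link , ↭-trans σ (↭.prep e τ))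

    hits : Pairing → Fin 4 → ℕ
    hits π i = bit (does (proj₁ (pair π zero) ≟ i) xor does (proj₂ (pair π zero) ≟ i)) +
               bit (does (proj₁ (pair π (suc zero)) ≟ i) xor does (proj₂ (pair π (suc zero)) ≟ i))

    hits≡1 : ∀ π i → hits π i ≡ 1
    hits≡1 12∣34 = from-yes (all? λ i → hits 12∣34 i ℕ.≟ 1)
    hits≡1 13∣24 = from-yes (all? λ i → hits 13∣24 i ℕ.≟ 1)
    hits≡1 14∣23 = from-yes (all? λ i → hits 14∣23 i ℕ.≟ 1)

    -- A perfect matching meets every terminal exactly once, so using one up costs the degree bound
    -- no more than the one join that it yields.
    matching-degᵗ : ∀ π {e f L L′} → LinkedPair π zero e → LinkedPair π (suc zero) f → L ↭ e ∷ f ∷ L′ →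
                    ∀ i → degᵗ i L ≡ suc (degᵗ i L′)
    matching-degᵗ π {e} {f} {L} {L′} le lf σ i = begin
      degᵗ i L                           ≡⟨ Σₗ-↭ (δᵢ ∘ ends) σ ⟩
      δᵢ (ends e) + (δᵢ (ends f) + degᵗ i L′) ≡⟨ sym (+-assoc (δᵢ (ends e)) _ _) ⟩
      (δᵢ (ends e) + δᵢ (ends f)) + degᵗ i L′ ≡⟨ cong (_+ degᵗ i L′)
                                                (cong₂ _+_ (δ-single {T = e} i le) (δ-single {T = f} i lf)) ⟩
      hits π i + degᵗ i L′               ≡⟨ cong (_+ degᵗ i L′) (hits≡1 π i) ⟩
      suc (degᵗ i L′)                    ∎
      where
      open ≡-Reasoning
      δᵢ : Fin (n G) × Fin (n G) → ℕ
      δᵢ = δ (single (v i))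

    crossing : ∀ i T → Pure v T →
               δ (single (v i)) (ends T) ≡ 0 ⊎ (∃[ j ] j ≢ i × Linked (v i) (v j) T)
    crossing i T pure with source T ≟ v i in p | target T ≟ v i in q
    ... | yes _  | yes _  = inj₁ refl
    ... | no _   | no _   = inj₁ refl
    ... | yes eq | no neq with pure i (target T) (inj₁ (cong (_, target T) eq))
    ...   | j , refl′ = inj₂ (j , (λ { refl → neq (sym refl′) }) , inj₁ (cong₂ _,_ eq (sym refl′)))
    crossing i T pure | no neq | yes eq with pure i (source T) (inj₂ (cong (source T ,_) eq))
    ...   | j , refl′ = inj₂ (j , (λ { refl → neq (sym refl′) }) , inj₂ (cong₂ _,_ (sym refl′) eq))

    mult : Fin 4 → Fin 4 → List Trail → ℕ
    mult a b = Σₗ (λ T → bit (does (linked? a b T)))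

    Covers : (i a b c : Fin 4) → Set
    Covers i a b c = ∀ j → j ≡ i ⊎ j ≡ a ⊎ j ≡ b ⊎ j ≡ c

    covers? : ∀ i a b c → Dec (Covers i a b c)
    covers? i a b c = all? λ j → (j ≟ i) ⊎-dec (j ≟ a) ⊎-dec (j ≟ b) ⊎-dec (j ≟ c)

    bit≤1 : ∀ b → bit b ≤ 1
    bit≤1 true  = ≤-refl
    bit≤1 false = z≤n

    -- A pure trail crossing the singleton of `v i` ends at another terminal, and `v c` is the only
    -- one not ruled out.
    degᵗ≤mult : ∀ i c a b {_ : True (covers? i c a b)} {L} → All (Pure v) L →
                Missing i a L → Missing i b L → degᵗ i L ≤ mult i c L
    degᵗ≤mult i c a b {cov} {L} pure ma mb = Σₗ-mono (All.zipWith (λ {T} → bound {T}) (pure , All.zip (ma , mb)))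
      where
      bound : ∀ {T} → Pure v T × ¬ Linked (v i) (v a) T × ¬ Linked (v i) (v b) T →
              δ (single (v i)) (ends T) ≤ bit (does (linked? i c T))
      bound {T} (p , ¬a , ¬b) with crossing i T p
      ... | inj₁ eq = ≤-trans (≤-reflexive eq) z≤n
      ... | inj₂ (j , j≢i , l) with toWitness cov j
      ...   | inj₁ j≡i                = contradiction j≡i j≢i
      ...   | inj₂ (inj₁ refl)        = subst (δ (single (v i)) (ends T) ≤_)
                                          (sym (cong bit (dec-true (linked? i c T) l))) (bit≤1 _)
      ...   | inj₂ (inj₂ (inj₁ refl)) = contradiction l ¬a
      ...   | inj₂ (inj₂ (inj₂ refl)) = contradiction l ¬b

    mult-missing : ∀ {a b L} → Missing a b L → mult a b L ≡ 0
    mult-missing {a} {b} {L} miss =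
      trans (Σₗ-cong (All.map (λ {T} ¬l → cong bit (dec-false (linked? a b T) ¬l)) miss)) (Σₗ-0 L)

    mult-here : ∀ {a b T L L′} → Linked (v a) (v b) T → L ↭ T ∷ L′ → mult a b L ≡ suc (mult a b L′)
    mult-here {a} {b} {T} {L′ = L′} l σ =
      trans (Σₗ-↭ _ σ) (cong (λ d → bit d + mult a b L′) (dec-true (linked? a b T) l))

    mult-elsewhere : ∀ {a b c T L L′} → a ≢ b → Linked (v a) (v c) T → L ↭ T ∷ L′ →
                     mult b c L ≡ mult b c L′
    mult-elsewhere {a} {b} {c} {T} {L′ = L′} a≢b l σ =
      trans (Σₗ-↭ _ σ) (cong (λ d → bit d + mult b c L′) (dec-false (linked? b c T) not-linked))
      where
      not-linked : ¬ Linked (v b) (v c) T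
      not-linked l′ with Linked-unique {T = T} l l′
      ... | inj₁ (a≡b , _)   = a≢b a≡b
      ... | inj₂ (a≡c , c≡b) = a≢b (trans a≡c c≡b)

    mult⇒Any : ∀ a b L {k} → suc k ≤ mult a b L → Any (Linked (v a) (v b)) L
    mult⇒Any a b L le with Any.any? (linked? a b) L
    ... | yes found = found
    ... | no none   = contradiction (subst (suc _ ≤_) (mult-missing (All.¬Any⇒All¬ L none)) le) λ ()

    -- The centre is itself a terminal: two legs concatenated there join one pair, and the third leg
    -- joins the other pair. `join` takes care of the orientation, which depends on the centre.
    module Star (c : Fin 4) {a b d : Fin 4} (a≢b : a ≢ b) (a≢d : a ≢ d) (b≢d : b ≢ d)
                (join : ∀ {es fs gs} → Walk G (v a) (v c) es → Walk G (v b) (v c) fs → Walk G (v d) (v c) gs →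
                        ∃[ J ] es ++ fs ++ gs ↭ edgesOf J) where

      -- Each trail belongs to at most one of the three legs, so one round lowers all three
      -- multiplicities by exactly one.
      starPacking : ∀ k L → k ≤ mult a c L → k ≤ mult b c L → k ≤ mult d c L → Packing k (support L)
      starPacking zero    _ _  _  _  = []
      starPacking (suc k) L ka kb kd with extract (mult⇒Any a c L ka)
      ... | e , L₁ , le , σ₁ with extract (mult⇒Any b c L₁ (subst (suc k ≤_) (mult-elsewhere a≢b le σ₁) kb))
      ... | f , L₂ , lf , σ₂ with extract (mult⇒Any d c L₂ (subst (suc k ≤_)
                               (trans (mult-elsewhere a≢d le σ₁) (mult-elsewhere b≢d lf σ₂)) kd))
      ... | g , L₃ , lg , σ₃ with orient v e le | orient v f lf | orient v g lg
      ... | es , p , es↭ | fs , q , fs↭ | gs , r , gs↭ with join p q r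
      ... | J , J↭ = J ⟨ perm ⟩∷ starPacking k L₃
          (drop (trans (mult-here le σ₁) (cong suc (trans (mult-elsewhere (a≢b ∘ sym) lf σ₂)
                                                          (mult-elsewhere (a≢d ∘ sym) lg σ₃)))) ka)
          (drop (trans (mult-elsewhere a≢b le σ₁) (trans (mult-here lf σ₂)
                                                         (cong suc (mult-elsewhere (b≢d ∘ sym) lg σ₃)))) kb)
          (drop (trans (mult-elsewhere a≢d le σ₁) (trans (mult-elsewhere b≢d lf σ₂) (mult-here lg σ₃))) kd)
        where
        drop : ∀ {x y} → x ≡ suc y → suc k ≤ x → k ≤ y
        drop refl = s≤s⁻¹
        perm : support L ↭ edgesOf J ++ support L₃
        perm = begin
          support L                                    ↭⟨ support-↭ (↭-trans σ₁ (↭.prep e (↭-trans σ₂ (↭.prep f σ₃)))) ⟩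
          steps e ++ steps f ++ steps g ++ support L₃  ↭⟨ ++⁺ (↭-sym es↭) (++⁺ (↭-sym fs↭) (++⁺ʳ _ (↭-sym gs↭))) ⟩
          es ++ fs ++ gs ++ support L₃                 ≡⟨ sym (trans (++-assoc es (fs ++ gs) _)
                                                                    (cong (es ++_) (++-assoc fs gs _))) ⟩
          (es ++ fs ++ gs) ++ support L₃               ↭⟨ ++⁺ʳ _ J↭ ⟩
          edgesOf J ++ support L₃                      ∎
          where open PermutationReasoning

    -- Induction on `k`, removing a perfect matching if there is one. Otherwise every pairing has an
    -- unjoined pair; of the eight ways to choose one pair from each pairing, four give the three
    -- pairs at one terminal and four give a triangle.
    packing : ∀ k L → All (Pure v) L → (∀ i → k ≤ degᵗ i L) → Packing k (support L)
    packing zero    L pure deg = []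
    packing (suc k) L pure deg = by-cases (matching? 12∣34 L) (matching? 13∣24 L) (matching? 14∣23 L)
      where
      Matching : Pairing → Set
      Matching π = ∃[ e ] ∃[ f ] ∃[ L′ ] LinkedPair π zero e × LinkedPair π (suc zero) f × L ↭ e ∷ f ∷ L′

      step : ∀ π → Matching π → Packing (suc k) (support L)
      step π (e , f , L′ , le , lf , σ) with orient v e le | orient v f lf
      ... | es , p , es↭ | fs , q , fs↭ =
        mkJoin π p q ⟨ perm ⟩∷
        packing k L′ (All.tail (All.tail (All-resp-↭ σ pure)))
                (λ i → s≤s⁻¹ (subst (suc k ≤_) (matching-degᵗ π le lf σ i) (deg i)))
        where
        perm : support L ↭ (es ++ fs) ++ support L′
        perm = begin
          support L                          ↭⟨ support-↭ σ ⟩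
          steps e ++ steps f ++ support L′   ↭⟨ ++⁺ (↭-sym es↭) (++⁺ʳ _ (↭-sym fs↭)) ⟩
          es ++ fs ++ support L′             ≡⟨ sym (++-assoc es fs _) ⟩
          (es ++ fs) ++ support L′           ∎
          where open PermutationReasoning

      isolated : ∀ i a b c {_ : True (covers? i a b c)} →
                 Missing i a L → Missing i b L → Missing i c L → Packing (suc k) (support L)
      isolated i a b c {cov} ma mb mc = contradiction
        (≤-trans (deg i) (≤-trans (degᵗ≤mult i a b c {cov} pure mb mc) (≤-reflexive (mult-missing ma)))) λ ()

      leaf : ∀ i c a b {_ : True (covers? i c a b)} → Missing i a L → Missing i b L → suc k ≤ mult i c L
      leaf i c a b {cov} ma mb = ≤-trans (deg i) (degᵗ≤mult i c a b {cov} pure ma mb)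

      by-cases : Matching 12∣34 ⊎ _ → Matching 13∣24 ⊎ _ → Matching 14∣23 ⊎ _ → Packing (suc k) (support L)
      by-cases (inj₁ found) _ _ = step 12∣34 found
      by-cases _ (inj₁ found) _ = step 13∣24 found
      by-cases _ _ (inj₁ found) = step 14∣23 found
      -- The unjoined pairs share a terminal, whose degree would be zero, against the bound `suc k`.
      by-cases (inj₂ (zero , m01)) (inj₂ (zero , m02)) (inj₂ (zero , m03)) =
        isolated 0F 1F 2F 3F m01 m02 m03
      by-cases (inj₂ (zero , m01)) (inj₂ (suc zero , m13)) (inj₂ (suc zero , m12)) =
        isolated 1F 0F 2F 3F (Missing-sym m01) m12 m13
      by-cases (inj₂ (suc zero , m23)) (inj₂ (zero , m02)) (inj₂ (suc zero , m12)) =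
        isolated 2F 0F 1F 3F (Missing-sym m02) (Missing-sym m12) m23
      by-cases (inj₂ (suc zero , m23)) (inj₂ (suc zero , m13)) (inj₂ (zero , m03)) =
        isolated 3F 0F 1F 2F (Missing-sym m03) (Missing-sym m13) (Missing-sym m23)
      -- The unjoined pairs form a triangle, so at each of its corners at least `suc k` trails lead
      -- to the fourth terminal, the centre. The pairing `12∣34` serves for every centre.
      by-cases (inj₂ (suc zero , m23)) (inj₂ (suc zero , m13)) (inj₂ (suc zero , m12)) =
        Star.starPacking 0F {1F} {2F} {3F} (λ ()) (λ ()) (λ ()) join (suc k) L
          (leaf 1F 0F 2F 3F m12 m13)
          (leaf 2F 0F 1F 3F (Missing-sym m12) m23)
          (leaf 3F 0F 1F 2F (Missing-sym m13) (Missing-sym m23))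
        where
        join : ∀ {es fs gs} → Walk G (v 1F) (v 0F) es → Walk G (v 2F) (v 0F) fs → Walk G (v 3F) (v 0F) gs →
               ∃[ J ] es ++ fs ++ gs ↭ edgesOf J
        join p q r with reverseʷ p | reverseʷ r
        ... | _ , p′ , σ | _ , r′ , τ = mkJoin 12∣34 p′ (q ++ʷ r′) , ++⁺ (↭-sym σ) (++⁺ˡ _ (↭-sym τ))
      by-cases (inj₂ (suc zero , m23)) (inj₂ (zero , m02)) (inj₂ (zero , m03)) =
        Star.starPacking 1F {0F} {2F} {3F} (λ ()) (λ ()) (λ ()) join (suc k) L
          (leaf 0F 1F 2F 3F m02 m03)
          (leaf 2F 1F 0F 3F (Missing-sym m02) m23)
          (leaf 3F 1F 0F 2F (Missing-sym m03) (Missing-sym m23))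
        where
        join : ∀ {es fs gs} → Walk G (v 0F) (v 1F) es → Walk G (v 2F) (v 1F) fs → Walk G (v 3F) (v 1F) gs →
               ∃[ J ] es ++ fs ++ gs ↭ edgesOf J
        join {es} {fs} p q r with reverseʷ r
        ... | _ , r′ , τ = mkJoin 12∣34 p (q ++ʷ r′) , ++⁺ˡ es (++⁺ˡ fs (↭-sym τ))
      by-cases (inj₂ (zero , m01)) (inj₂ (suc zero , m13)) (inj₂ (zero , m03)) =
        Star.starPacking 2F {0F} {1F} {3F} (λ ()) (λ ()) (λ ()) join (suc k) L
          (leaf 0F 2F 1F 3F m01 m03)
          (leaf 1F 2F 0F 3F (Missing-sym m01) m13)
          (leaf 3F 2F 0F 1F (Missing-sym m03) (Missing-sym m13))
        where
        join : ∀ {es fs gs} → Walk G (v 0F) (v 2F) es → Walk G (v 1F) (v 2F) fs → Walk G (v 3F) (v 2F) gs →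
               ∃[ J ] es ++ fs ++ gs ↭ edgesOf J
        join {es} p q r with reverseʷ q | reverseʷ r
        ... | _ , q′ , σ | _ , r′ , τ = mkJoin 12∣34 (p ++ʷ q′) r′ ,
          ↭-trans (++⁺ˡ es (++⁺ (↭-sym σ) (↭-sym τ))) (↭-reflexive (sym (++-assoc es _ _)))
      by-cases (inj₂ (zero , m01)) (inj₂ (zero , m02)) (inj₂ (suc zero , m12)) =
        Star.starPacking 3F {0F} {1F} {2F} (λ ()) (λ ()) (λ ()) join (suc k) L
          (leaf 0F 3F 1F 2F m01 m02)
          (leaf 1F 3F 0F 2F (Missing-sym m01) m12)
          (leaf 2F 3F 0F 1F (Missing-sym m02) (Missing-sym m12))
        where
        join : ∀ {es fs gs} → Walk G (v 0F) (v 3F) es → Walk G (v 1F) (v 3F) fs → Walk G (v 2F) (v 3F) gs →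
               ∃[ J ] es ++ fs ++ gs ↭ edgesOf J
        join {es} p q r with reverseʷ q
        ... | _ , q′ , σ = mkJoin 12∣34 (p ++ʷ q′) r ,
          ↭-trans (++⁺ˡ es (++⁺ʳ _ (↭-sym σ))) (↭-reflexive (sym (++-assoc es _ _)))

-- Duplicate-free lists and counting.

Unique-++⁻ : {A : Set} (xs : List A) {ys : List A} → Unique (xs ++ ys) →
             Unique xs × Unique ys × (∀ {x} → x ∈ xs → ¬ x ∈ ys)
Unique-++⁻ []       u        = [] , u , λ ()
Unique-++⁻ (x ∷ xs) (x∉ ∷ u) with Unique-++⁻ xs u | All.++⁻ xs x∉
... | u₁ , u₂ , disj | x∉xs , x∉ys =
  x∉xs ∷ u₁ , u₂ , λ { (here refl) y∈ → All.lookup x∉ys y∈ refl ; (there x∈) y∈ → disj x∈ y∈ }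

Unique-↭ : {A : Set} {xs ys : List A} → xs ↭ ys → Unique xs → Unique ys
Unique-↭ {A} σ = ↭ₛ.Unique-resp-↭ (setoid A) (↭⇒↭ₛ σ)

∣tabulate∣ : ∀ {m} (f : Fin m → Bool) → ∣ Vec.tabulate f ∣ ≡ Σₗ (bit ∘ f) (allFin m)
∣tabulate∣ {zero}  f = refl
∣tabulate∣ {suc m} f with f zero
... | true  = cong suc (trans (∣tabulate∣ (f ∘ suc)) (sym (Σₗ-allFin-suc (bit ∘ f))))
... | false = trans (∣tabulate∣ (f ∘ suc)) (sym (Σₗ-allFin-suc (bit ∘ f)))

length-filter : {A : Set} {P : A → Set} (P? : Decidable P) (xs : List A) →
                length (filter P? xs) ≡ Σₗ (bit ∘ does ∘ P?) xs
length-filter P? []       = refl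
length-filter P? (x ∷ xs) with does (P? x)
... | true  = cong suc (length-filter P? xs)
... | false = length-filter P? xs

-- Parity of cuts

2∣+⇒%≡% : ∀ x y → 2 ∣ x + y → x % 2 ≡ y % 2
2∣+⇒%≡% x y 2∣ = begin
  x % 2             ≡⟨ sym ([m+kn]%n≡m%n x y 2) ⟩
  (x + y * 2) % 2   ≡⟨ cong (_% 2) (solve 2 (λ x y → x :+ y :* con 2 := (x :+ y) :+ y) refl x y) ⟩
  ((x + y) + y) % 2 ≡⟨ %-remove-+ˡ y 2∣ ⟩
  y % 2             ∎
  where
  open ≡-Reasoning
  open +-*-Solver

2∣m+m : ∀ m → 2 ∣ m + m
2∣m+m m = divides m (trans (cong (m +_) (sym (+-identityʳ m))) (*-comm 2 m))

-- An edge crosses a set exactly when one of its two ends lies inside, so modulo two crossing equals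
-- the number of ends inside.
2∣xor : ∀ a b → 2 ∣ bit (a xor b) + (bit a + bit b)
2∣xor true  true  = divides 1 refl
2∣xor true  false = divides 1 refl
2∣xor false true  = divides 1 refl
2∣xor false false = divides 0 refl

module _ (G : Graph) where

  incidence : Fin (n G) → Fin (m G) → ℕ
  incidence y e = bit (does (proj₁ (∂ G e) ≟ y)) + bit (does (proj₂ (∂ G e) ≟ y))

  -- The degree counts edges and the incidence counts ends; they agree because no edge has both ends
  -- at `y`.
  degree≡Σincidence : ∀ y → degree G y ≡ Σₗ (incidence y) (allFin (m G))
  degree≡Σincidence y = trans
    (length-filter (λ e → (proj₁ (∂ G e) ≟ y) ⊎-dec (proj₂ (∂ G e) ≟ y)) (allFin (m G)))
    (Σₗ-cong (All.universal split (allFin (m G))))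
    where
    split : ∀ e → bit (does ((proj₁ (∂ G e) ≟ y) ⊎-dec (proj₂ (∂ G e) ≟ y))) ≡ incidence y e
    split e with proj₁ (∂ G e) ≟ y | proj₂ (∂ G e) ≟ y
    ... | yes p | yes q = contradiction (trans p (sym q)) (loopless G e)
    ... | yes _ | no _  = refl
    ... | no _  | yes _ = refl
    ... | no _  | no _  = refl

  -- Pairs of an edge and one of its ends are counted in two orders, each with the weight of the
  -- end. The indicator of a vertex set is the weight used below.
  handshake : ∀ (g : Fin (n G) → ℕ) →
              Σₗ (λ e → g (proj₁ (∂ G e)) + g (proj₂ (∂ G e))) (allFin (m G)) ≡
              Σₗ (λ y → g y * degree G y) (allFin (n G))
  handshake g = begin
    Σₗ (λ e → g (proj₁ (∂ G e)) + g (proj₂ (∂ G e))) E       ≡⟨ Σₗ-cong (All.universal expand E) ⟩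
    Σₗ (λ e → Σₗ (λ y → g y * incidence y e) V) E            ≡⟨ Σₗ-swap (λ e y → g y * incidence y e) E V ⟩
    Σₗ (λ y → Σₗ (λ e → g y * incidence y e) E) V            ≡⟨ Σₗ-cong (All.universal collect V) ⟩
    Σₗ (λ y → g y * degree G y) V                            ∎
    where
    open ≡-Reasoning
    E : List (Fin (m G))
    E = allFin (m G)
    V : List (Fin (n G))
    V = allFin (n G)
    expand : ∀ e → g (proj₁ (∂ G e)) + g (proj₂ (∂ G e)) ≡ Σₗ (λ y → g y * incidence y e) V
    expand e = sym (trans
      (Σₗ-cong (All.universal (λ y → *-distribˡ-+ (g y) _ _) V))
      (trans (Σₗ-+ (λ y → g y * bit (does (proj₁ (∂ G e) ≟ y))) _ V)
             (cong₂ _+_ (Σₗ-indicator g (proj₁ (∂ G e))) (Σₗ-indicator g (proj₂ (∂ G e))))))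
    collect : ∀ y → Σₗ (λ e → g y * incidence y e) E ≡ g y * degree G y
    collect y = trans (Σₗ-*ˡ (g y) (incidence y) E) (cong (g y *_) (sym (degree≡Σincidence y)))

  boundary : VSet (n G) → ℕ
  boundary Z = Σₗ (δ Z ∘ ∂ G) (allFin (m G))

  degreeSum : VSet (n G) → ℕ
  degreeSum Z = Σₗ (λ y → bit (Z y) * degree G y) (allFin (n G))

  2∣boundary+degreeSum : ∀ Z → 2 ∣ boundary Z + degreeSum Z
  2∣boundary+degreeSum Z = subst (2 ∣_)
    (trans (Σₗ-+ (δ Z ∘ ∂ G) _ (allFin (m G))) (cong (boundary Z +_) (handshake (bit ∘ Z))))
    (Σₗ-∣ (λ e → 2∣xor (Z (proj₁ (∂ G e))) (Z (proj₂ (∂ G e)))) (allFin (m G)))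

  -- Each boundary has the parity of its degree sum, and vertices on which the two sets differ have
  -- even degree.
  2∣boundaries : ∀ Z Z′ → (∀ y → Z y ≡ Z′ y ⊎ 2 ∣ degree G y) → 2 ∣ boundary Z + boundary Z′
  2∣boundaries Z Z′ agree = ∣m+n∣m⇒∣n
    (subst (2 ∣_)
      (trans (+-interchange (boundary Z) (degreeSum Z) _ _) (+-comm (boundary Z + boundary Z′) _))
      (∣m∣n⇒∣m+n (2∣boundary+degreeSum Z) (2∣boundary+degreeSum Z′)))
    (subst (2 ∣_) (Σₗ-+ (λ y → bit (Z y) * degree G y) _ (allFin (n G))) (Σₗ-∣ even (allFin (n G))))
    where
    even : ∀ y → 2 ∣ bit (Z y) * degree G y + bit (Z′ y) * degree G y
    even y with agree y
    ... | inj₁ eq rewrite eq = 2∣m+m (bit (Z′ y) * degree G y)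
    ... | inj₂ 2∣d = ∣m∣n⇒∣m+n (∣n⇒∣m*n (bit (Z y)) 2∣d) (∣n⇒∣m*n (bit (Z′ y)) 2∣d)

  crossingEdges : VSet (n G) → Subset (m G)
  crossingEdges Z = Vec.tabulate (λ e → Z (proj₁ (∂ G e)) xor Z (proj₂ (∂ G e)))

  -- A walk changes sides only along a crossing edge.
  avoiding-walk : ∀ Z {u w es} → Walk G u w es → All (_∉ crossingEdges Z) es → Z u ≡ Z w
  avoiding-walk Z nil []                = refl
  avoiding-walk Z (cons e j p) (e∉ ∷ a) = trans (same e j e∉) (avoiding-walk Z p a)
    where
    xor-false : ∀ a b → ¬ (a xor b ≡ true) → a ≡ b
    xor-false true  true  _  = refl
    xor-false false false _  = refl
    xor-false true  false ¬p = contradiction refl ¬p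
    xor-false false true  ¬p = contradiction refl ¬p
    ends-agree : ∀ e → e ∉ crossingEdges Z → Z (proj₁ (∂ G e)) ≡ Z (proj₂ (∂ G e))
    ends-agree e e∉ = xor-false _ _ λ eq →
      e∉ (lookup⇒[]= e (crossingEdges Z) (trans (lookup∘tabulate _ e) eq))
    same : ∀ {u w} e → Joins G e u w → e ∉ crossingEdges Z → Z u ≡ Z w
    same e (inj₁ eq) e∉ with ends-agree e e∉
    ... | agree rewrite eq = agree
    same e (inj₂ eq) e∉ with ends-agree e e∉
    ... | agree rewrite eq = sym agree

-- The invariant at the start, from the hypotheses.

Splits : Pairing → Fin 4 → Set
Splits π i = ∃[ q ] does (proj₁ (pair π q) ≟ i) ≢ does (proj₂ (pair π q) ≟ i)

splits? : ∀ π i → Dec (Splits π i)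
splits? π i = any? λ q → ¬? (does (proj₁ (pair π q) ≟ i) Bool.≟ does (proj₂ (pair π q) ≟ i))

-- One of the two pairs contains `i`, and its other member is a different terminal.
pairing-splits : ∀ π i → Splits π i
pairing-splits 12∣34 = from-yes (all? (splits? 12∣34))
pairing-splits 13∣24 = from-yes (all? (splits? 13∣24))
pairing-splits 14∣23 = from-yes (all? (splits? 14∣23))

module Theorem (k : ℕ) (G : Graph) (v : Fin 4 → Fin (n G)) (v-inj : Injective _≡_ _≡_ v)
  (even : ∀ (y : Fin (n G)) → (∀ i → v i ≢ y) → 2 ∣ degree G y)
  (robust : ∀ (D : Subset (m G)) → ∣ D ∣ < k →
       ∃[ π ] Σ (Path G (v (proj₁ (pair π zero))) (v (proj₂ (pair π zero)))) λ P₁ →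
              Σ (Path G (v (proj₁ (pair π (suc zero)))) (v (proj₂ (pair π (suc zero))))) λ P₂ →
              Avoids P₁ D × Avoids P₂ D × EdgeDisjoint P₁ P₂) where

  open Trails G
  open Splitting v ends
  open FourTerminals v v-inj
  open Join

  -- If fewer than `k` edges crossed `Z`, deleting them all would leave paths joining both pairs of
  -- some pairing, yet one of these pairs has its members on opposite sides of `Z`.
  k≤boundary : ∀ {i Z} → Separates i Z → k ≤ boundary G Z
  k≤boundary {i} {Z} (separates at) = ≮⇒≥ λ small →
    let ∣D∣ = ∣tabulate∣ λ e → Z (proj₁ (∂ G e)) xor Z (proj₂ (∂ G e))
        π , P₁ , P₂ , a₁ , a₂ , _ = robust (crossingEdges G Z) (subst (_< k) (sym ∣D∣) small)
        q , differ = pairing-splits π i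
    in differ (trans (sym (at _)) (trans (linked π q P₁ P₂ a₁ a₂) (at _)))
    where
    linked : ∀ π q → (P₁ : Path G (v (proj₁ (pair π zero))) (v (proj₂ (pair π zero)))) →
             (P₂ : Path G (v (proj₁ (pair π (suc zero)))) (v (proj₂ (pair π (suc zero))))) →
             Avoids P₁ (crossingEdges G Z) → Avoids P₂ (crossingEdges G Z) →
             Z (v (proj₁ (pair π q))) ≡ Z (v (proj₂ (pair π q)))
    linked π zero       P₁ P₂ a₁ a₂ = avoiding-walk G Z (walk P₁) a₁
    linked π (suc zero) P₁ P₂ a₁ a₂ = avoiding-walk G Z (walk P₂) a₂

  edgeTrail : Fin (m G) → Trail
  edgeTrail e = record { route = cons e (inj₁ refl) nil }

  initial : List Trail
  initial = map edgeTrail (allFin (m G))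

  support-initial : ∀ es → support (map edgeTrail es) ≡ es
  support-initial []       = refl
  support-initial (e ∷ es) = cong (e ∷_) (support-initial es)

  cut-initial : ∀ Z → cut Z initial ≡ boundary G Z
  cut-initial Z = cong sum (sym (map-∘ (allFin (m G))))

  -- The least number ≥ k with the parity common to all cuts separating v i.
  κ : Fin 4 → ℕ
  κ i = k + (k + boundary G (single (v i))) % 2

  -- Sets separating the same terminal agree on all terminals, so their boundaries have equal
  -- parity. Writing a boundary as `k + x`, the remainder of `x` modulo two is thus the one built
  -- into `κ i`, and `x / 2` counts the surplus pairs.
  initial-Inv : Inv κ initial
  initial-Inv .Inv.excess {i} {Z} sep@(separates at) with m≤n⇒∃[o]m+o≡n (k≤boundary sep)
  ... | x , k+x≡ = x / 2 , (begin
    cut Z initial            ≡⟨ trans (cut-initial Z) (sym k+x≡) ⟩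
    k + x                    ≡⟨ cong (k +_) (m≡m%n+[m/n]*n x 2) ⟩
    k + (x % 2 + x / 2 * 2)  ≡⟨ sym (+-assoc k _ _) ⟩
    k + x % 2 + x / 2 * 2    ≡⟨ cong (λ r → k + r + x / 2 * 2) (2∣+⇒%≡% x (k + b) 2∣) ⟩
    κ i + x / 2 * 2          ∎)
    where
    open ≡-Reasoning
    b : ℕ
    b = boundary G (single (v i))
    agree : ∀ y → Z y ≡ single (v i) y ⊎ 2 ∣ degree G y
    agree y with any? (λ j → v j ≟ y)
    ... | yes (j , refl) = inj₁ (trans (at j) (sym (single-at i j)))
    ... | no y∉          = inj₂ (even y λ j eq → y∉ (j , eq))
    2∣ : 2 ∣ x + (k + b)
    2∣ = subst (2 ∣_)
      (trans (cong (_+ b) (trans (sym k+x≡) (+-comm k x))) (+-assoc x k b))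
      (2∣boundaries G Z (single (v i)) agree)

  -- The bound `k ≤ κ i`, applied to the singletons of the terminals, supplies the minimum degree.
  edgePacking : Packing k (allFin (m G))
  edgePacking with purify v v-inj κ initial (<-wellFounded _) initial-Inv
  ... | L , inv , pure , σ = Packing-↭ (↭-trans (↭-reflexive (sym (support-initial _))) σ)
    (packing k L pure λ i → ≤-trans (m≤m+n k _) (Inv⇒≤ κ inv (single-separates v-inj i)))

  -- Reading off the edge-disjoint paths.

  joinAt : ∀ {k es} → Packing k es → Fin k → Join
  joinAt (J ⟨ _ ⟩∷ Js) zero    = J
  joinAt (J ⟨ _ ⟩∷ Js) (suc j) = joinAt Js j

  joinAt-⊆ : ∀ {k es} (Js : Packing k es) j {x} → x ∈ edgesOf (joinAt Js j) → x ∈ es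
  joinAt-⊆ (J ⟨ σ ⟩∷ Js) zero    x∈ = ∈-resp-↭ (↭-sym σ) (∈-++⁺ˡ x∈)
  joinAt-⊆ (J ⟨ σ ⟩∷ Js) (suc j) x∈ = ∈-resp-↭ (↭-sym σ) (∈-++⁺ʳ (edgesOf J) (joinAt-⊆ Js j x∈))

  joinAt-unique : ∀ {k es} (Js : Packing k es) → Unique es → ∀ j → Unique (edgesOf (joinAt Js j))
  joinAt-unique (J ⟨ σ ⟩∷ Js) u zero    = proj₁ (Unique-++⁻ (edgesOf J) (Unique-↭ σ u))
  joinAt-unique (J ⟨ σ ⟩∷ Js) u (suc j) =
    joinAt-unique Js (proj₁ (proj₂ (Unique-++⁻ (edgesOf J) (Unique-↭ σ u)))) j

  -- An edge shared by two different joins would occur twice in the list.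
  joinAt-disjoint : ∀ {k es} (Js : Packing k es) → Unique es → ∀ j j′ {x} →
                    x ∈ edgesOf (joinAt Js j) → x ∈ edgesOf (joinAt Js j′) → j ≡ j′
  joinAt-disjoint (J ⟨ σ ⟩∷ Js) u j j′ x∈ x∈′ with Unique-++⁻ (edgesOf J) (Unique-↭ σ u)
  joinAt-disjoint (J ⟨ σ ⟩∷ Js) u zero    zero     x∈ x∈′ | _ = refl
  joinAt-disjoint (J ⟨ σ ⟩∷ Js) u zero    (suc j′) x∈ x∈′ | _ , _ , disj =
    contradiction (joinAt-⊆ Js j′ x∈′) (disj x∈)
  joinAt-disjoint (J ⟨ σ ⟩∷ Js) u (suc j) zero     x∈ x∈′ | _ , _ , disj =
    contradiction (joinAt-⊆ Js j x∈) (disj x∈′)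
  joinAt-disjoint (J ⟨ σ ⟩∷ Js) u (suc j) (suc j′) x∈ x∈′ | _ , u′ , _ =
    cong suc (joinAt-disjoint Js u′ j j′ x∈ x∈′)

  module _ (Js : Packing k (allFin (m G))) where

    unique : ∀ j → Unique (edgesOf (joinAt Js j))
    unique = joinAt-unique Js (allFin⁺ (m G))

    path : (j : Fin k) (i : Fin 2) →
           Path G (v (proj₁ (pair (pairing (joinAt Js j)) i))) (v (proj₂ (pair (pairing (joinAt Js j)) i)))
    path j zero       = mkPath _ (first (joinAt Js j)) (proj₁ (Unique-++⁻ _ (unique j)))
    path j (suc zero) = mkPath _ (second (joinAt Js j)) (proj₁ (proj₂ (Unique-++⁻ (es (joinAt Js j)) (unique j))))

    path-⊆ : ∀ j i {x} → x ∈ edges (path j i) → x ∈ edgesOf (joinAt Js j)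
    path-⊆ j zero       = ∈-++⁺ˡ
    path-⊆ j (suc zero) = ∈-++⁺ʳ (es (joinAt Js j))

    -- A shared edge forces both paths into the same join, where the absence of repetitions in the
    -- concatenated edge list separates its two walks.
    paths-disjoint : ∀ j i j′ i′ → (j , i) ≢ (j′ , i′) → EdgeDisjoint (path j i) (path j′ i′)
    paths-disjoint j i j′ i′ ne e e∈ e∈′
      with joinAt-disjoint Js (allFin⁺ (m G)) j j′ (path-⊆ j i e∈) (path-⊆ j′ i′ e∈′)
         | Unique-++⁻ (es (joinAt Js j)) (unique j)
    paths-disjoint j zero       j zero       ne e e∈ e∈′ | refl | _            = ne refl
    paths-disjoint j zero       j (suc zero) ne e e∈ e∈′ | refl | _ , _ , disj = disj e∈ e∈′
    paths-disjoint j (suc zero) j zero       ne e e∈ e∈′ | refl | _ , _ , disj = disj e∈′ e∈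
    paths-disjoint j (suc zero) j (suc zero) ne e e∈ e∈′ | refl | _            = ne refl

theorem2p11 : (k : ℕ) → 1 ≤ k →
    (G : Graph) → (v : Fin 4 → Fin (n G)) → Injective _≡_ _≡_ v →
    (∀ (y : Fin (n G)) → (∀ i → v i ≢ y) → 2 ∣ degree G y) →
    (∀ (D : Subset (m G)) → ∣ D ∣ < k →
    ∃[ π ] Σ (Path G (v (proj₁ (pair π zero))) (v (proj₂ (pair π zero)))) λ P₁ →
    Σ (Path G (v (proj₁ (pair π (suc zero)))) (v (proj₂ (pair π (suc zero))))) λ P₂ →
    Avoids P₁ D × Avoids P₂ D × EdgeDisjoint P₁ P₂) →
    Σ (Fin k → Pairing) λ π →
    Σ ((j : Fin k) (i : Fin 2) → Path G (v (proj₁ (pair (π j) i))) (v (proj₂ (pair (π j) i)))) λ P →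
    ∀ j i j' i' → (j , i) ≢ (j' , i') → EdgeDisjoint (P j i) (P j' i')
theorem2p11 k _ G v v-inj even robust =
  (λ j → Join.pairing (joinAt edgePacking j)) , path edgePacking , paths-disjoint edgePacking
  where
  open Trails.FourTerminals G v v-inj
  open Theorem k G v v-inj even robust
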